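{- In the setting described in the context, suppose the system starts from a recurrent state and $v_1$ follows an anti-threshold rule. Then one of the following holds: (i) $(c_t)$ is constant and the system has period $1$ or $2$; (ii) $(c_t)$ alternates and the system has period $2$; (iii) $(c_t)$ periodically repeats the sequence $+1,+1,-1,-1$ and the system has period $4$; (iv) $(c_t)$ periodically repeats $+1,+1,+1,-1,-1,-1$ and the system has period $6$; (v) $(c_t)$ periodically repeats $x,x,x,-x$ for some $x\in\{+1,-1\}$ and the system has period $4$; (vi) $(c_t)$ periodically repeats $x,x,x,-x,-x$ for some $x\in\{+1,-1\}$ and the system has period $5$ or $10$; (vii) $(c_t)$ periodically repeats $x,-x,-x$ for some $x\in\{+1,-1\}$ and the system has period $3$ or $6$; or (viii) $(c_t)$ periodically repeats $x,-x,-x,x,x,-x,-x,-x$ for some $x\in\{+1,-1\}$ and the system has period $8$. Moreover, if $G$ has no loops then one of (i)--(vi) holds.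
   Context: $G$ is a finite graph (loops allowed, no multiple edges) on vertex set $\{v_1,\dots,v_n\}$; $N_i$ is the neighbourhood of $v_i$ (including $v_i$ iff there is a loop at $v_i$). Each vertex holds an opinion in $\{+1,-1\}$; $U_t$ is the set of vertices with opinion $+1$ at time $t$. All vertices update simultaneously: $v_i\in U_{t+1}$ iff $N_i\cap U_t\in\mathcal S_i$, where for $i\ge2$, $\mathcal S_i=\{A\subseteq N_i:|A|\ge r_i\}$ (threshold rule, integer $r_i$), and $v_1$ follows an anti-threshold rule: $\mathcal S_1=\{A\subseteq N_1:|A|<r_1\}$ for some integer $r_1$. Starting from a recurrent state means $U_p=U_0$ for some $p\ge1$; the period of the system is the least such $p$. $c_t\in\{+1,-1\}$ denotes the opinion of $v_1$ at time $t$ ("repeats the sequence" is read up to a shift of time). -}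

module Defs where

open import Data.Nat using (ℕ; zero; suc; _+_; _≤_; _<_)
open import Data.Nat.DivMod using (_mod_)
open import Data.Integer as ℤ using (ℤ; +_)
open import Data.Bool using (Bool; true; false; not; _∧_; if_then_else_)
open import Data.Fin using (Fin)
open import Data.List using (List; map)
open import Data.Nat.ListAction using (sum)
open import Data.List.Base using (allFin)
open import Data.Vec using (Vec; lookup; tabulate)
open import Data.Product using (_×_; ∃)
open import Data.Sum using (_⊎_)
open import Relation.Nullary using (¬_; does)
open import Relation.Binary.PropositionalEquality using (_≡_)

-- Opinions: true = +1, false = -1.
Opinion : Set
Opinion = Bool

record Graph (n : ℕ) : Set where
  field
    adj  : Fin n → Fin n → Bool
    sym  : ∀ i j → adj i j ≡ adj j i

NoLoops : ∀ {n} → Graph n → Set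
NoLoops {n} G = ∀ (i : Fin n) → Graph.adj G i i ≡ false

-- A state: the opinion of every vertex (U_t = set of vertices with true).
State : ℕ → Set
State n = Vec Opinion n

count : ∀ {n} → Graph n → Fin n → State n → ℕ
count {n} G i U =
  sum (map (λ j → if Graph.adj G i j ∧ lookup U j then 1 else 0) (allFin n))

-- One synchronous update step. Vertex v_1 is Fin.zero and follows the
-- anti-threshold rule |N_1 ∩ U| < r_1; every other vertex v_i follows the
-- threshold rule |N_i ∩ U| ≥ r_i. Thresholds are arbitrary integers.
step : ∀ {m} → Graph (suc m) → (Fin (suc m) → ℤ) → State (suc m) → State (suc m)
step G r U = tabulate rule
  where
  rule : Fin _ → Bool
  rule Fin.zero    = does ((+ count G Fin.zero U) ℤ.<? r Fin.zero)
  rule (Fin.suc k) = does (r (Fin.suc k) ℤ.≤? (+ count G (Fin.suc k) U))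

traj : ∀ {m} → Graph (suc m) → (Fin (suc m) → ℤ) → State (suc m) → ℕ → State (suc m)
traj G r U0 zero    = U0
traj G r U0 (suc t) = step G r (traj G r U0 t)

opinion₁ : ∀ {m} → Graph (suc m) → (Fin (suc m) → ℤ) → State (suc m) → ℕ → Opinion
opinion₁ G r U0 t = lookup (traj G r U0 t) Fin.zero

Recurrent : ∀ {m} → Graph (suc m) → (Fin (suc m) → ℤ) → State (suc m) → Set
Recurrent G r U0 = ∃ λ p → 1 ≤ p × traj G r U0 p ≡ U0

IsPeriod : ∀ {m} → Graph (suc m) → (Fin (suc m) → ℤ) → State (suc m) → ℕ → Set
IsPeriod G r U0 p =
  1 ≤ p × traj G r U0 p ≡ U0 × (∀ q → 1 ≤ q → q < p → ¬ (traj G r U0 q ≡ U0))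

Repeats : ∀ {L} → Vec Bool (suc L) → (ℕ → Bool) → Set
Repeats {L} s c = ∃ λ k → ∀ t → c t ≡ lookup s ((t + k) mod suc L)

open Data.Vec using ([]; _∷_)

Constant : (ℕ → Bool) → Set
Constant c = ∀ t → c t ≡ c 0

Alternates : (ℕ → Bool) → Set
Alternates c = ∀ t → c (suc t) ≡ not (c t)

module _ (c : ℕ → Bool) (p : ℕ) where
  CaseI    = Constant c × (p ≡ 1 ⊎ p ≡ 2)
  CaseII   = Alternates c × p ≡ 2
  CaseIII  = Repeats (true ∷ true ∷ false ∷ false ∷ []) c × p ≡ 4
  CaseIV   = Repeats (true ∷ true ∷ true ∷ false ∷ false ∷ false ∷ []) c × p ≡ 6
  CaseV    = ∃ λ (x : Bool) → Repeats (x ∷ x ∷ x ∷ not x ∷ []) c × p ≡ 4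
  CaseVI   = ∃ λ (x : Bool) → Repeats (x ∷ x ∷ x ∷ not x ∷ not x ∷ []) c × (p ≡ 5 ⊎ p ≡ 10)
  CaseVII  = ∃ λ (x : Bool) → Repeats (x ∷ not x ∷ not x ∷ []) c × (p ≡ 3 ⊎ p ≡ 6)
  CaseVIII = ∃ λ (x : Bool) →
               Repeats (x ∷ not x ∷ not x ∷ x ∷ x ∷ not x ∷ not x ∷ not x ∷ []) c × p ≡ 8

  Cases1to6 : Set
  Cases1to6 = CaseI ⊎ CaseII ⊎ CaseIII ⊎ CaseIV ⊎ CaseV ⊎ CaseVI

  Cases1to8 : Set
  Cases1to8 = Cases1to6 ⊎ CaseVII ⊎ CaseVIII

{-# OPTIONS --safe #-}
module Submission where

-- Call v₁ the nonconformist and the other vertices conformists.  Write A_t for the set of conformists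
-- with opinion +1 and c_t for the opinion of v₁.  The Goles–Olivos energy of two consecutive states,
-- taken over the conformists only and with each neighbour of v₁ given the mean of its two effective
-- thresholds, never decreases; on a recurrent orbit it is therefore constant.  Hence a conformist changes
-- its opinion between times t - 1 and t + 1 only if it is pivotal at time t: it sees v₁, it adopts c_t, and
-- with the other value of c_t it would have adopted the other opinion.
--
-- Consequently, if c_t = -1 and A_t ⊆ A_s then A_{t+1} ⊆ A_{s+1} and A_{t+1} ⊆ A_{s-1}; there is a dual rule
-- for c = +1.  Moreover, if s ≡ t modulo 2, then A_t ⊆ A_s, c_{t+1} = -1 and c_{s+1} = +1 are only possible if A_t = A_s, c_t = +1,
-- c_s = -1 and v₁ has a loop.  These rules exclude a short list of factors from the word c, and a recurrent
-- word without these factors is one of those in the theorem.  They also yield an inclusion A_t ⊆ A_{t+d} along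
-- each of these words, which by recurrence is an equality, so that the period divides d.

open import Defs
open import Data.Nat as ℕ using (ℕ; zero; suc; z≤n; s≤s)
import Data.Nat.Properties as ℕ
open import Data.Nat.DivMod using (_mod_; _%_; _/_; m≡m%n+[m/n]*n; m%n<n; m%n%n≡m%n; %-distribˡ-+)
open import Data.Nat.Divisibility using (_∣_; _∣?_; ∣⇒≤; m%n≡0⇒n∣m)
open import Data.Nat.ListAction using () renaming (sum to sumₗ)
open import Data.Integer as ℤ using (ℤ; +_; 0ℤ; 1ℤ; _+_; _-_; _*_; _≤_; _<_; _≤?_; _<?_)
open import Data.Integer.Properties hiding (_≤?_; _<?_; _≟_)
open import Data.Integer.Tactic.RingSolver using (solve-∀)
open import Algebra.Properties.Semiring.Sum +-*-semiring
  using (sum; sum-cong-≗; ∑-distrib-+; ∑-comm; *-distribˡ-sum; sum-replicate-zero)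
open import Data.Bool using (Bool; true; false; not; _∧_; _∨_; if_then_else_; _≟_; T; T?)
open import Data.Bool.Properties using (not-involutive; ¬-not; not-¬; ∧-zeroʳ; ∧-identityʳ; T-∧; T-∨)
open import Data.Bool.ListAction using (any)
open import Data.Empty using (⊥; ⊥-elim)
open import Data.Fin using (Fin; zero; suc; toℕ)
open import Data.Fin.Properties using (toℕ-injective; toℕ-fromℕ<)
open import Data.Vec using (Vec; lookup; []; _∷_)
open import Data.Vec.Properties using (lookup∘tabulate; tabulate∘lookup; tabulate-cong)
open import Data.List using (List; []; _∷_; map; tabulate; upTo; take; drop; filter)
open import Data.List.Membership.Propositional using (_∈_)
open import Data.List.Membership.Propositional.Properties using (∈-filter⁺; ∈-upTo⁺)
open import Data.List.Relation.Unary.All as All using (All; []; _∷_)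
open import Data.List.Relation.Unary.Any as Any using (here; there)
open import Data.List.Relation.Unary.Any.Properties using (any⁻)
open import Data.Product as Product using (_×_; _,_; proj₁; proj₂; ∃)
open import Data.Sum as Sum using (_⊎_; inj₁; inj₂; [_,_]′)
open import Data.Unit using (⊤; tt)
open import Function using (_∘_; id; Equivalence)
open import Relation.Nullary using (¬_; Dec; does; yes; no; contradiction)
open import Relation.Nullary.Decidable using (⌊_⌋; toWitness; fromWitness; dec-true; dec-false)
open import Relation.Binary.PropositionalEquality

-- Periods, integer order and finite sums.

iterate-period : ∀ {a} {A : Set a} (f : ℕ → A) {d} → (∀ t → f (d ℕ.+ t) ≡ f t) →
  ∀ k t → f (k ℕ.* d ℕ.+ t) ≡ f t
iterate-period f     e zero    t = refl
iterate-period f {d} e (suc k) t =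
  trans (cong f (ℕ.+-assoc d (k ℕ.* d) t)) (trans (e (k ℕ.* d ℕ.+ t)) (iterate-period f e k t))

does⇒ : ∀ {a} {A : Set a} (d : Dec A) → does d ≡ true → A
does⇒ (yes a) _ = a

does⇒¬ : ∀ {a} {A : Set a} (d : Dec A) → does d ≡ false → ¬ A
does⇒¬ (no ¬a) _ = ¬a

+-cancelˡ-≤ : ∀ k i j → k + i ≤ k + j → i ≤ j
+-cancelˡ-≤ k i j k+i≤k+j = ≮⇒≥ λ j<i → <⇒≱ (+-monoʳ-< k j<i) k+i≤k+j

+-cancelʳ-≤ : ∀ k i j → i + k ≤ j + k → i ≤ j
+-cancelʳ-≤ k i j rewrite +-comm i k | +-comm j k = +-cancelˡ-≤ k i j

sum-mono : ∀ {n} {f g : Fin n → ℤ} → (∀ i → f i ≤ g i) → sum f ≤ sum g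
sum-mono {zero}  f≤g = ≤-refl
sum-mono {suc n} f≤g = +-mono-≤ (f≤g zero) (sum-mono (f≤g ∘ suc))

sum-mono-≡ : ∀ {n} {f g : Fin n → ℤ} → (∀ i → f i ≤ g i) → sum g ≤ sum f → ∀ i → f i ≡ g i
sum-mono-≡ {suc n} {f} {g} f≤g Σg≤Σf zero = ≤-antisym (f≤g zero)
  (+-cancelʳ-≤ (sum (g ∘ suc)) (g zero) (f zero) (≤-trans Σg≤Σf (+-monoʳ-≤ (f zero) (sum-mono (f≤g ∘ suc)))))
sum-mono-≡ {suc n} {f} {g} f≤g Σg≤Σf (suc i) = sum-mono-≡ (f≤g ∘ suc)
  (+-cancelˡ-≤ (g zero) (sum (g ∘ suc)) (sum (f ∘ suc)) (≤-trans Σg≤Σf (+-monoˡ-≤ (sum (f ∘ suc)) (f≤g zero)))) i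

χ : Bool → ℤ
χ b = + (if b then 1 else 0)

χ-mono : ∀ {a b} → (a ≡ true → b ≡ true) → χ a ≤ χ b
χ-mono {false} {false} _ = ≤-refl
χ-mono {false} {true}  _ = ℤ.+≤+ z≤n
χ-mono {true}  {b} a⇒b rewrite a⇒b refl = ≤-refl

χ-∧-swap : ∀ a x y → χ x * χ (a ∧ y) ≡ χ y * χ (a ∧ x)
χ-∧-swap false x y = trans (*-zeroʳ (χ x)) (sym (*-zeroʳ (χ y)))
χ-∧-swap true  x y = *-comm (χ x) (χ y)

-- The Goles-Olivos energy.

module SymmetricForm {m} (a : Fin m → Fin m → Bool) (a-sym : ∀ i j → a i j ≡ a j i) (θ : Fin m → ℤ) where

  field-at : (Fin m → Bool) → Fin m → ℤ
  field-at y i = sum λ j → χ (a i j ∧ y j)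

  pairing : (x y : Fin m → Bool) → ℤ
  pairing x y = sum λ i → χ (x i) * field-at y i

  pairing-sym : ∀ x y → pairing x y ≡ pairing y x
  pairing-sym x y = begin
    pairing x y
      ≡⟨ sum-cong-≗ (λ i → *-distribˡ-sum (χ (x i)) (λ j → χ (a i j ∧ y j))) ⟩
    sum (λ i → sum λ j → χ (x i) * χ (a i j ∧ y j))
      ≡⟨ ∑-comm (λ i j → χ (x i) * χ (a i j ∧ y j)) ⟩
    sum (λ j → sum λ i → χ (x i) * χ (a i j ∧ y j))
      ≡⟨ sum-cong-≗ (λ j → sum-cong-≗ λ i → trans (χ-∧-swap (a i j) (x i) (y j))
           (cong (λ e → χ (y j) * χ (e ∧ x i)) (a-sym i j))) ⟩
    sum (λ j → sum λ i → χ (y j) * χ (a j i ∧ x i))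
      ≡⟨ sum-cong-≗ (λ j → *-distribˡ-sum (χ (y j)) (λ i → χ (a j i ∧ x i))) ⟨
    pairing y x ∎
    where open ≡-Reasoning

  weight : (Fin m → Bool) → ℤ
  weight x = sum λ i → χ (x i) * θ i

  -- The Goles-Olivos energy with reversed sign, so that it grows; `θ` stands for minus twice the
  -- threshold. It is written as an affine function of `x` whose coefficients are local fields of
  -- `y`; the symmetry hidden by this form is recovered in `energy-sym`.
  energy : (x y : Fin m → Bool) → ℤ
  energy x y = sum λ i → χ (x i) * (field-at y i + field-at y i + θ i) + χ (y i) * θ i

  energy-split : ∀ x y → energy x y ≡ (pairing x y + pairing x y) + (weight x + weight y)
  energy-split x y = begin
    energy x y
      ≡⟨ sum-cong-≗ (λ i → expand (χ (x i)) (field-at y i) (θ i) (χ (y i))) ⟩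
    sum (λ i → (P i + P i) + (V x i + V y i))
      ≡⟨ ∑-distrib-+ (λ i → P i + P i) (λ i → V x i + V y i) ⟩
    sum (λ i → P i + P i) + sum (λ i → V x i + V y i)
      ≡⟨ cong₂ _+_ (∑-distrib-+ P P) (∑-distrib-+ (V x) (V y)) ⟩
    (pairing x y + pairing x y) + (weight x + weight y) ∎
    where
    open ≡-Reasoning
    P = λ i → χ (x i) * field-at y i
    V = λ (z : Fin m → Bool) i → χ (z i) * θ i
    expand : ∀ p q h s → p * (q + q + h) + s * h ≡ (p * q + p * q) + (p * h + s * h)
    expand = solve-∀

  energy-sym : ∀ x y → energy x y ≡ energy y x
  energy-sym x y = begin
    energy x y                                          ≡⟨ energy-split x y ⟩
    (pairing x y + pairing x y) + (weight x + weight y)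
      ≡⟨ cong₂ _+_ (cong₂ _+_ (pairing-sym x y) (pairing-sym x y)) (+-comm (weight x) (weight y)) ⟩
    (pairing y x + pairing y x) + (weight y + weight x) ≡⟨ energy-split y x ⟨
    energy y x                                          ∎
    where open ≡-Reasoning

  gain : (x y z : Fin m → Bool) → Fin m → ℤ
  gain x y z i = (χ (z i) - χ (x i)) * (field-at y i + field-at y i + θ i)

  -- By symmetry both energies can be written with `y` in the second place, and then only the affine
  -- dependence on the first argument makes a difference.
  energy-gain : ∀ x y z → energy z y ≡ energy y x + sum (gain x y z)
  energy-gain x y z = begin
    energy z y
      ≡⟨ sum-cong-≗ (λ i → telescope (χ (z i)) (χ (x i)) (field-at y i + field-at y i + θ i) (χ (y i) * θ i)) ⟩
    sum (λ i → (χ (x i) * (field-at y i + field-at y i + θ i) + χ (y i) * θ i) + gain x y z i)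
      ≡⟨ ∑-distrib-+ (λ i → χ (x i) * (field-at y i + field-at y i + θ i) + χ (y i) * θ i) (gain x y z) ⟩
    energy x y + sum (gain x y z)
      ≡⟨ cong (_+ sum (gain x y z)) (energy-sym x y) ⟩
    energy y x + sum (gain x y z) ∎
    where
    open ≡-Reasoning
    telescope : ∀ p q h s → p * h + s ≡ (q * h + s) + (p - q) * h
    telescope = solve-∀

-- `E` never decreases and returns to its value after `suc p` steps, so no increment on the way can
-- be positive.
periodic-increments-vanish : (E S : ℕ → ℤ) (p : ℕ) → (∀ t → E (suc p ℕ.+ t) ≡ E t) →
  (∀ t → E (suc t) ≡ E t + S t) → (∀ t → 0ℤ ≤ S t) → ∀ t → S t ≤ 0ℤ
periodic-increments-vanish E S p period increment 0≤S t =
  +-cancelˡ-≤ (E t) (S t) 0ℤ (begin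
    E t + S t           ≡⟨ increment t ⟨
    E (suc t)           ≤⟨ grow p (suc t) ⟩
    E (p ℕ.+ suc t)     ≡⟨ cong E (ℕ.+-suc p t) ⟩
    E (suc p ℕ.+ t)     ≡⟨ period t ⟩
    E t                 ≡⟨ +-identityʳ (E t) ⟨
    E t + 0ℤ            ∎)
  where
  open ≤-Reasoning
  grow : ∀ k t → E t ≤ E (k ℕ.+ t)
  grow zero    t = ≤-refl
  grow (suc k) t = begin
    E t                              ≤⟨ grow k t ⟩
    E (k ℕ.+ t)                      ≡⟨ +-identityʳ _ ⟨
    E (k ℕ.+ t) + 0ℤ                 ≤⟨ +-monoʳ-≤ (E (k ℕ.+ t)) (0≤S (k ℕ.+ t)) ⟩
    E (k ℕ.+ t) + S (k ℕ.+ t)        ≡⟨ increment (k ℕ.+ t) ⟨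
    E (suc k ℕ.+ t)                  ∎

-- θ is such that a flip gains nothing exactly when the nonconformist is seen (β) and decides on it.
module _ (β : Bool) (M r : ℤ) where

  private
    θ = χ β + 1ℤ - (r + r)

  -- The margin for adopting `x` when the nonconformist favours `x`, hence nonnegative as soon as
  -- `x` is adopted at all. The `1ℤ` turns the strict inequality for opinion -1 into a weak one.
  slack : Bool → ℤ
  slack true  = χ β + M - r
  slack false = r - 1ℤ - M

  slack-gain : ∀ x → (χ x - χ (not x)) * (M + M + θ) ≡ slack x + slack x + (1ℤ - χ β)
  slack-gain true  = lemma (χ β) M r
    where
    lemma : ∀ b M r → (1ℤ - 0ℤ) * (M + M + (b + 1ℤ - (r + r))) ≡ (b + M - r) + (b + M - r) + (1ℤ - b)
    lemma = solve-∀
  slack-gain false = lemma (χ β) M r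
    where
    lemma : ∀ b M r → (0ℤ - 1ℤ) * (M + M + (b + 1ℤ - (r + r))) ≡ (r - 1ℤ - M) + (r - 1ℤ - M) + (1ℤ - b)
    lemma = solve-∀

even : ℕ → Bool
even zero    = true
even (suc n) = not (even n)

χ-injective : ∀ {a b} → χ a ≡ χ b → a ≡ b
χ-injective {false} {false} _ = refl
χ-injective {true}  {true}  _ = refl

list-sum : ∀ {n} {A : Set} (f : A → ℕ) (g : Fin n → A) → + sumₗ (map f (tabulate g)) ≡ sum (λ j → + f (g j))
list-sum {zero}  f g = refl
list-sum {suc n} f g = trans (pos-+ (f (g zero)) _) (cong (λ z → + f (g zero) + z) (list-sum f (g ∘ suc)))

-- Given `B ≤ A`, only the indicators can produce the strict inequality, and they contribute at most
-- one unit.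
χ-shift-< : ∀ u v {A B} → χ u + A < χ v + B → B ≤ A → u ≡ false × v ≡ true × A ≤ B
χ-shift-< u false {A} {B} lt B≤A = contradiction
  (≤-trans (≤-reflexive (+-identityˡ B)) (≤-trans B≤A (i≤j+i A (χ u)))) (<⇒≱ lt)
χ-shift-< true  true lt B≤A = contradiction (+-monoʳ-≤ 1ℤ B≤A) (<⇒≱ lt)
χ-shift-< false true {A} {B} lt B≤A = refl , refl , ≮⇒≥ λ B<A →
  <⇒≱ lt (≤-trans (i<j⇒suc[i]≤j B<A) (≤-reflexive (sym (+-identityˡ A))))

∧-true : ∀ {a b} → a ∧ b ≡ true → a ≡ true × b ≡ true
∧-true {true} {true} _ = refl , refl

≢⇒not : ∀ {a b : Bool} → ¬ a ≡ b → b ≡ not a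
≢⇒not ¬e = ¬-not (¬e ∘ sym)

-- Binary words and decidable tests on them.

Word : Set
Word = List Bool

-- Words are read up to exchanging the opinions: relative to x, the letter I stands for x and O for not x.
pattern I = true
pattern O = false

_·_ : Bool → Bool → Bool
x · I = x
x · O = not x

matches : Bool → Word → Word → Bool
matches x []      w       = true
matches x (b ∷ f) []      = false
matches x (b ∷ f) (a ∷ w) = ⌊ a ≟ x · b ⌋ ∧ matches x f w

-- All listed factors begin with `I`, so `x` can only be the first letter.
hits : List Word → Word → Bool
hits F []      = false
hits F (a ∷ w) = any (λ f → matches a f (a ∷ w)) F

agree : Bool → ℕ → Word → Word → Bool
agree σ zero    v       w       = true
agree σ (suc K) (a ∷ v) (b ∷ w) = ⌊ b ≟ a · σ ⌋ ∧ agree σ K v w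
-- A word too short for the comparison fails, so no word is discarded for a lag before the lag is
-- verified on it in full.
agree σ (suc K) _       _       = false

-- lag σ L K is the property c_{t+L} = ± c_t of K consecutive letters, with the sign + for σ = I.
record Lag : Set where
  constructor lag
  field
    sign        : Bool
    delay range : ℕ

lagged : Lag → Word → Bool
lagged (lag σ L K) w = agree σ K w (drop L w)

fits : ∀ {L} → Vec Bool (suc L) → ℕ → Word → Bool
fits s k []              = true
fits {L} s k (a ∷ w) = ⌊ a ≟ lookup s (k mod suc L) ⌋ ∧ fits s (suc k) w

fits-some : ∀ {L} → (Bool → Vec Bool (suc L)) → Word → Bool
fits-some {L} s w = any (λ x → any (λ k → fits (s x) k w) (upTo (suc L))) (true ∷ false ∷ [])

occurs : Word → Word → Bool
occurs f []      = false
occurs f (a ∷ w) = any (λ x → matches x f (a ∷ w)) (true ∷ false ∷ []) ∨ occurs f w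

excluding : List Word → List Lag → Word → Bool
excluding F ls w = hits F w ∨ any (λ l → lagged l w) ls

-- Checks all words of length n without bad factors.  Words are extended to the left, so that a bad factor
-- is detected as a prefix.
explore : (bad good : Word → Bool) → ℕ → Word → Bool
explore bad good zero    w = good w
explore bad good (suc n) w = grow true ∧ grow false
  where
  grow : Bool → Bool
  grow b = bad (b ∷ w) ∨ explore bad good n (b ∷ w)

_⇒_ : (q r : Word → Bool) → Word → Bool
(q ⇒ r) w = not (q w) ∨ r w

-- The first letter is only context: that a nonconstant word never ends in a long run follows from the factors
-- reaching across the left end of the run.
persistent : (Word → Bool) → Word → Bool
persistent q = (q ∘ take 11 ∘ drop 1) ⇒ (q ∘ take 11 ∘ drop 2)

-- Besides the repeated pattern, an occurrence of `f` is wanted, as the place where an inclusion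
-- starts. The most demanding case is period 8 with `f` of length 8: in 15 letters each of the eight
-- phases is seen.
cycling : ∀ {L} → (Bool → Vec Bool (suc L)) → Word → Bool → ℕ → Word → Bool
cycling s f σ d = lagged (lag σ d (15 ℕ.∸ d)) ⇒ λ w → fits-some s w ∧ occurs f w

T-∧⁻ : ∀ {a b} → T (a ∧ b) → T a × T b
T-∧⁻ = Equivalence.to T-∧

⇒-elim : ∀ q r {w} → T ((q ⇒ r) w) → T (q w) → T (r w)
⇒-elim q r {w} h hq with q w
... | true = h

T-not : ∀ {b} → T (not b) → ¬ T b
T-not {false} _ ()

¬T-not : ∀ {b} → ¬ T (not b) → T b
¬T-not {false} h = contradiction tt h
¬T-not {true}  _ = tt

-- Soundness of the tests on an infinite sequence.

module Windows (c : ℕ → Bool) where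

  window : ℕ → ℕ → Word
  window zero    t = []
  window (suc n) t = c t ∷ window n (suc t)

  Spells : Bool → Word → ℕ → Set
  Spells x []      t = ⊤
  Spells x (b ∷ f) t = c t ≡ x · b × Spells x f (suc t)

  Never : Word → Set
  Never f = ∀ x t → ¬ Spells x f t

  Agrees : Bool → ℕ → ℕ → ℕ → Set
  Agrees σ zero    s t = ⊤
  Agrees σ (suc K) s t = c t ≡ c s · σ × Agrees σ K (suc s) (suc t)

  Lagged : Lag → ℕ → Set
  Lagged (lag σ L K) t = Agrees σ K t (L ℕ.+ t)

  matches-sound : ∀ x f n t → T (matches x f (window n t)) → Spells x f t
  matches-sound x []      n       t _ = tt
  matches-sound x (b ∷ f) (suc n) t h with T-∧⁻ h
  ... | h₁ , h₂ = toWitness h₁ , matches-sound x f n (suc t) h₂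

  any-spells : ∀ f n t → T (any (λ x → matches x f (window n t)) (true ∷ false ∷ [])) → ∃ λ x → Spells x f t
  any-spells f n t h with Any.satisfied (any⁻ _ (true ∷ false ∷ []) h)
  ... | x , m = x , matches-sound x f n t m

  hits-sound : ∀ {F} → All Never F → ∀ n t → ¬ T (hits F (window n t))
  hits-sound (never ∷ nevers) (suc n) t h with Equivalence.to T-∨ h
  ... | inj₁ h₁ = never (c t) t (matches-sound (c t) _ (suc n) t h₁)
  ... | inj₂ h₂ = hits-sound nevers (suc n) t h₂

  occurs-sound : ∀ f n t → T (occurs f (window n t)) → ∃ λ x → ∃ λ s → Spells x f s
  occurs-sound f (suc n) t h with Equivalence.to T-∨ h
  ... | inj₁ h₁ = let x , sp = any-spells f (suc n) t h₁ in x , t , sp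
  ... | inj₂ h₂ = occurs-sound f n (suc t) h₂

  drop-window : ∀ L n t → drop L (window n t) ≡ window (n ℕ.∸ L) (L ℕ.+ t)
  drop-window zero    n       t = refl
  drop-window (suc L) zero    t = refl
  drop-window (suc L) (suc n) t = trans (drop-window L n (suc t)) (cong (window (n ℕ.∸ L)) (ℕ.+-suc L t))

  agree-sound : ∀ σ K m n s t → T (agree σ K (window m s) (window n t)) → Agrees σ K s t
  agree-sound σ zero    m       n       s t _ = tt
  agree-sound σ (suc K) (suc m) (suc n) s t h with T-∧⁻ h
  ... | h₁ , h₂ = toWitness h₁ , agree-sound σ K m n (suc s) (suc t) h₂

  agree-complete : ∀ σ {K m n} s t → K ℕ.≤ m → K ℕ.≤ n → Agrees σ K s t → T (agree σ K (window m s) (window n t))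
  agree-complete σ s t z≤n       _         _ = tt
  agree-complete σ s t (s≤s K≤m) (s≤s K≤n) (e , h) =
    Equivalence.from T-∧ (fromWitness e , agree-complete σ (suc s) (suc t) K≤m K≤n h)

  lagged-sound : ∀ l n t → T (lagged l (window n t)) → Lagged l t
  lagged-sound (lag σ L K) n t h = agree-sound σ K n (n ℕ.∸ L) t (L ℕ.+ t)
    (subst (λ w → T (agree σ K (window n t) w)) (drop-window L n t) h)

  lagged-complete : ∀ l n t → Lag.range l ℕ.≤ n ℕ.∸ Lag.delay l → Lagged l t → T (lagged l (window n t))
  lagged-complete (lag σ L K) n t K≤ h = subst (λ w → T (agree σ K (window n t) w)) (sym (drop-window L n t))
    (agree-complete σ t (L ℕ.+ t) (ℕ.≤-trans K≤ (ℕ.m∸n≤m n L)) K≤ h)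

  NeverLag : Lag → Set
  NeverLag l = ∀ t → ¬ Lagged l t

  lagged-any-sound : ∀ {ls} → All NeverLag ls → ∀ n t → ¬ T (any (λ l → lagged l (window n t)) ls)
  lagged-any-sound (never ∷ nevers) n t h with Equivalence.to T-∨ h
  ... | inj₁ h₁ = never t (lagged-sound _ n t h₁)
  ... | inj₂ h₂ = lagged-any-sound nevers n t h₂

  excluding-sound : ∀ {F ls} → All Never F → All NeverLag ls → ∀ n t → ¬ T (excluding F ls (window n t))
  excluding-sound nevers neverlags n t h with Equivalence.to T-∨ h
  ... | inj₁ h₁ = hits-sound nevers n t h₁
  ... | inj₂ h₂ = lagged-any-sound neverlags n t h₂

  always-lagged : ∀ σ L K → (∀ t → c (L ℕ.+ t) ≡ c t · σ) → ∀ t → Lagged (lag σ L K) t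
  always-lagged σ L zero    e t = tt
  always-lagged σ L (suc K) e t = e t , subst (Agrees σ K (suc t)) (ℕ.+-suc L t) (always-lagged σ L K e (suc t))

  fits-sound : ∀ {L} (s : Vec Bool (suc L)) k n t → T (fits s k (window n t)) →
    ∀ i → i ℕ.< n → c (i ℕ.+ t) ≡ lookup s ((i ℕ.+ k) mod suc L)
  fits-sound {L} s k (suc n) t h i i<n with T-∧⁻ {⌊ c t ≟ lookup s (k mod suc L) ⌋} h
  fits-sound {L} s k (suc n) t h zero    _         | h₁ , h₂ = toWitness h₁
  fits-sound {L} s k (suc n) t h (suc i) (s≤s i<n) | h₁ , h₂ =
    subst₂ (λ u v → c u ≡ lookup s (v mod suc L)) (ℕ.+-suc i t) (ℕ.+-suc i k)
      (fits-sound s (suc k) n (suc t) h₂ i i<n)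

  Spells-shift : ∀ {d} → (∀ t → c (d ℕ.+ t) ≡ c t) → ∀ {x} f {t} → Spells x f t → Spells x f (d ℕ.+ t)
  Spells-shift     e []              _        = tt
  Spells-shift {d} e {x} (b ∷ f) {t} (h , hs) =
    trans (e t) h , subst (Spells x f) (ℕ.+-suc d t) (Spells-shift e f hs)

  fits-some-sound : ∀ {L} (s : Bool → Vec Bool (suc L)) → (∀ t → c (suc L ℕ.+ t) ≡ c t) →
    ∀ n → suc L ℕ.≤ n → T (fits-some s (window n 0)) → ∃ λ x → Repeats (s x) c
  fits-some-sound {L} s e n L≤n h with Any.satisfied (any⁻ _ (true ∷ false ∷ []) h)
  ... | x , h′ with Any.satisfied (any⁻ _ (upTo (suc L)) h′)
  ...   | k , h″ = x , k , λ t → let i = t % suc L in begin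
    c t                                       ≡⟨ cong c (trans (m≡m%n+[m/n]*n t (suc L)) (ℕ.+-comm i _)) ⟩
    c (t / suc L ℕ.* suc L ℕ.+ i)             ≡⟨ iterate-period c e (t / suc L) i ⟩
    c i                                       ≡⟨ cong c (ℕ.+-identityʳ i) ⟨
    c (i ℕ.+ 0)                               ≡⟨ fits-sound (s x) k n 0 h″ i (ℕ.<-≤-trans (m%n<n t (suc L)) L≤n) ⟩
    lookup (s x) ((i ℕ.+ k) mod suc L)        ≡⟨ cong (lookup (s x)) (toℕ-injective (same-residue t k)) ⟩
    lookup (s x) ((t ℕ.+ k) mod suc L)        ∎
    where
    open ≡-Reasoning
    same-residue : ∀ t k → toℕ ((t % suc L ℕ.+ k) mod suc L) ≡ toℕ ((t ℕ.+ k) mod suc L)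
    same-residue t k = begin
      toℕ ((t % suc L ℕ.+ k) mod suc L)           ≡⟨ toℕ-fromℕ< _ ⟩
      (t % suc L ℕ.+ k) % suc L                   ≡⟨ %-distribˡ-+ (t % suc L) k (suc L) ⟩
      (t % suc L % suc L ℕ.+ k % suc L) % suc L   ≡⟨ cong (λ z → (z ℕ.+ k % suc L) % suc L) (m%n%n≡m%n t (suc L)) ⟩
      (t % suc L ℕ.+ k % suc L) % suc L           ≡⟨ %-distribˡ-+ t k (suc L) ⟨
      (t ℕ.+ k) % suc L                           ≡⟨ toℕ-fromℕ< _ ⟨
      toℕ ((t ℕ.+ k) mod suc L)                   ∎

  -- The window is revealed from its right end; at each node the branch of the letter that really
  -- precedes is followed.
  explore-sound : ∀ (bad good : Word → Bool) → (∀ n t → ¬ T (bad (window n t))) →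
    ∀ n → T (explore bad good n []) → ∀ t → T (good (window n t))
  explore-sound bad good never n h t =
    subst (λ k → T (good (window k t))) (ℕ.+-identityʳ n) (go n 0 h)
    where
    go : ∀ n k → T (explore bad good n (window k (n ℕ.+ t))) → T (good (window (n ℕ.+ k) t))
    go zero    k h = h
    go (suc n) k h = subst (λ j → T (good (window j t))) (ℕ.+-suc n k) (go n (suc k) (pick (T-∧⁻ h)))
      where
      w = window k (suc n ℕ.+ t)
      branch : Bool → Bool
      branch b = bad (b ∷ w) ∨ explore bad good n (b ∷ w)
      choose : ∀ b → T (branch true) × T (branch false) → T (branch b)
      choose true  = proj₁
      choose false = proj₂
      pick : T (branch true) × T (branch false) → T (explore bad good n (c (n ℕ.+ t) ∷ w))
      pick hs with Equivalence.to T-∨ (choose (c (n ℕ.+ t)) hs)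
      ... | inj₁ h₁ = contradiction h₁ (never (suc k) (n ℕ.+ t))
      ... | inj₂ h₂ = h₂

  module Recurrent (p : ℕ) (period : ∀ t → c (suc p ℕ.+ t) ≡ c t) where

    window-period : ∀ n t → window n (suc p ℕ.+ t) ≡ window n t
    window-period zero    t = refl
    window-period (suc n) t = cong₂ _∷_ (period t)
      (trans (cong (window n) (sym (ℕ.+-suc (suc p) t))) (window-period n (suc t)))

    -- If `q` holds once, it persists up to a multiple of the period, where the window equals that
    -- of time 0, and from there it persists for ever.
    dichotomy : ∀ (q : Word → Bool) → (∀ t → T (q (window 11 t)) → T (q (window 11 (suc t)))) →
      (∀ t → T (q (window 11 t))) ⊎ (∀ t → ¬ T (q (window 11 t)))
    dichotomy q keep with T? (q (window 11 0))
    ... | yes q₀ = inj₁ always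
      where
      always : ∀ t → T (q (window 11 t))
      always zero    = q₀
      always (suc t) = keep t (always t)
    ... | no ¬q₀ = inj₂ λ t qt → ¬q₀ (subst (T ∘ q) (window-multiple t)
        (subst (T ∘ q ∘ window 11) (ℕ.m∸n+n≡m (ℕ.m≤m*n t (suc p))) (later (t ℕ.* suc p ℕ.∸ t) t qt)))
      where
      window-multiple : ∀ k → window 11 (k ℕ.* suc p) ≡ window 11 0
      window-multiple k = trans (cong (window 11) (sym (ℕ.+-identityʳ (k ℕ.* suc p))))
        (iterate-period (window 11) (window-period 11) k 0)
      later : ∀ j t → T (q (window 11 t)) → T (q (window 11 (j ℕ.+ t)))
      later zero    t qt = qt
      later (suc j) t qt = keep (j ℕ.+ t) (later j t qt)

    module Excluding {F} (nevers : All Never F) ls (neverlags : All NeverLag ls) where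

      everywhere : ∀ good n → T (explore (excluding F ls) good n []) → ∀ t → T (good (window n t))
      everywhere good = explore-sound (excluding F ls) good (excluding-sound nevers neverlags)

      keep : ∀ q → T (explore (excluding F ls) (persistent q) 13 []) →
        ∀ t → T (q (window 11 t)) → T (q (window 11 (suc t)))
      -- The context letter is that of time t - 1, which recurrence provides at time `p + t` even
      -- when t = 0.
      keep q h t qt = subst (T ∘ q) (after (suc p ℕ.+ t) (suc t) (sym (ℕ.+-suc (suc p) t)))
        (⇒-elim (q ∘ take 11 ∘ drop 1) (q ∘ take 11 ∘ drop 2) {window 13 (p ℕ.+ t)}
          (everywhere (persistent q) 13 h (p ℕ.+ t))
          (subst (T ∘ q) (sym (window-period 11 t)) qt))
        where
        after : ∀ s t → suc s ≡ suc p ℕ.+ t → window 11 (suc s) ≡ window 11 t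
        after s t e = trans (cong (window 11) e) (window-period 11 t)

      module _ (σ : Bool) (L K : ℕ) {fits-window : T (suc K ℕ.≤ᵇ 11 ℕ.∸ L)} where

        private
          l = lag σ L (suc K)

          always : (∀ t → T (lagged l (window 11 t))) → ∀ t → c (L ℕ.+ t) ≡ c t · σ
          always h t = proj₁ (lagged-sound l 11 t (h t))

          complete : ∀ t → Lagged l t → T (lagged l (window 11 t))
          complete t = lagged-complete l 11 t (ℕ.≤ᵇ⇒≤ (suc K) (11 ℕ.∸ L) fits-window)

        persistent-stage : T (explore (excluding F ls) (persistent (lagged l)) 13 []) →
          (∀ t → c (L ℕ.+ t) ≡ c t · σ) ⊎ NeverLag l
        persistent-stage h = Sum.map always (λ never t → never t ∘ complete t)
          (dichotomy (lagged l) (keep (lagged l) h))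

        -- Here it is the failure of the lag that persists, so the lag fails at every time or at
        -- none.
        co-persistent-stage : T (explore (excluding F ls) (persistent (not ∘ lagged l)) 13 []) →
          (∀ t → c (L ℕ.+ t) ≡ c t · σ) ⊎ NeverLag l
        co-persistent-stage h = Sum.swap (Sum.map
          (λ never t → T-not (never t) ∘ complete t) (λ h → always (λ t → ¬T-not (h t)))
          (dichotomy (not ∘ lagged l) (keep (not ∘ lagged l) h)))

      cyclic : ∀ {L} (s : Bool → Vec Bool (suc L)) f → (∀ t → c (suc L ℕ.+ t) ≡ c t) →
        ∀ σ d → (∀ t → c (d ℕ.+ t) ≡ c t · σ) →
        T (explore (excluding F ls) (cycling s f σ d) 15 []) → T (suc L ℕ.≤ᵇ 15) →
        (∃ λ x → Repeats (s x) c) × (∃ λ x → ∃ λ t → Spells x f t)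
      cyclic {L} s f period-c σ d e h L≤ =
        Product.map (fits-some-sound s period-c 15 (ℕ.≤ᵇ⇒≤ (suc L) 15 L≤)) (occurs-sound f 15 0)
          (T-∧⁻ (⇒-elim (lagged l) (λ w → fits-some s w ∧ occurs f w) {window 15 0}
            (everywhere (cycling s f σ d) 15 h 0)
            (lagged-complete l 15 0 ℕ.≤-refl (always-lagged σ d (15 ℕ.∸ d) e 0))))
        where
        l = lag σ d (15 ℕ.∸ d)

-- Excluded factors, excluded lags and divisors.

-- Their occurrence is contradictory even if v₁ has a loop.
factors : List Word
factors =
  (I ∷ O ∷ I ∷ O ∷ O ∷ []) ∷
  (I ∷ I ∷ O ∷ O ∷ O ∷ O ∷ []) ∷
  (I ∷ I ∷ O ∷ O ∷ I ∷ O ∷ []) ∷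
  (I ∷ O ∷ I ∷ I ∷ I ∷ I ∷ []) ∷
  (I ∷ O ∷ I ∷ I ∷ O ∷ O ∷ O ∷ []) ∷
  (I ∷ O ∷ I ∷ I ∷ O ∷ I ∷ I ∷ I ∷ []) ∷
  (I ∷ O ∷ I ∷ I ∷ O ∷ I ∷ I ∷ O ∷ O ∷ []) ∷
  (I ∷ I ∷ I ∷ O ∷ O ∷ O ∷ I ∷ O ∷ []) ∷
  (I ∷ I ∷ I ∷ O ∷ O ∷ O ∷ I ∷ I ∷ O ∷ []) ∷
  (I ∷ I ∷ O ∷ O ∷ I ∷ I ∷ O ∷ O ∷ O ∷ []) ∷
  (I ∷ O ∷ O ∷ I ∷ I ∷ I ∷ O ∷ I ∷ I ∷ I ∷ []) ∷
  (I ∷ O ∷ I ∷ I ∷ I ∷ O ∷ O ∷ I ∷ I ∷ I ∷ O ∷ I ∷ []) ∷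
  (I ∷ I ∷ O ∷ O ∷ O ∷ I ∷ I ∷ O ∷ O ∷ O ∷ I ∷ O ∷ []) ∷ []

constant alternating antiperiod-3 period-3 antiperiod-2 period-5 period-4 : Lag
constant     = lag true 1 3
alternating  = lag false 1 3
antiperiod-3 = lag false 3 5
period-3     = lag true 3 4
antiperiod-2 = lag false 2 6
period-5     = lag true 5 5
period-4     = lag true 4 4

-- Once the lags of the preceding stage are excluded, the new one (for constant and period-4: its negation)
-- persists in time.
stage₁ stage₂ stage₃ stage₄ stage₅ stage₆ stage₇ : List Lag
stage₁ = constant ∷ []
stage₂ = alternating ∷ stage₁
stage₃ = antiperiod-3 ∷ stage₂
stage₄ = period-3 ∷ stage₃
stage₅ = antiperiod-2 ∷ stage₄
stage₆ = period-5 ∷ stage₅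
stage₇ = period-4 ∷ stage₆

-- For a numeral `n` the filtered list evaluates to the explicit list of divisors, so membership in
-- it is a finite case distinction.
divisors : ∀ {q} n → q ∣ suc n → q ∈ filter (_∣? suc n) (upTo (2 ℕ.+ n))
divisors n q∣ = ∈-filter⁺ (_∣? suc n) (∈-upTo⁺ (s≤s (∣⇒≤ q∣))) q∣

divisors-2 : ∀ {q} → q ∣ 2 → q ≡ 1 ⊎ q ≡ 2
divisors-2 q∣ with divisors 1 q∣
... | here e         = inj₁ e
... | there (here e) = inj₂ e

divisors-4 : ∀ {q} → q ∣ 4 → q ≡ 1 ⊎ q ≡ 2 ⊎ q ≡ 4
divisors-4 q∣ with divisors 3 q∣
... | here e                 = inj₁ e
... | there (here e)         = inj₂ (inj₁ e)
... | there (there (here e)) = inj₂ (inj₂ e)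

divisors-6 : ∀ {q} → q ∣ 6 → q ≡ 1 ⊎ q ≡ 2 ⊎ q ≡ 3 ⊎ q ≡ 6
divisors-6 q∣ with divisors 5 q∣
... | here e                         = inj₁ e
... | there (here e)                 = inj₂ (inj₁ e)
... | there (there (here e))         = inj₂ (inj₂ (inj₁ e))
... | there (there (there (here e))) = inj₂ (inj₂ (inj₂ e))

divisors-8 : ∀ {q} → q ∣ 8 → q ≡ 1 ⊎ q ≡ 2 ⊎ q ≡ 4 ⊎ q ≡ 8
divisors-8 q∣ with divisors 7 q∣
... | here e                         = inj₁ e
... | there (here e)                 = inj₂ (inj₁ e)
... | there (there (here e))         = inj₂ (inj₂ (inj₁ e))
... | there (there (there (here e))) = inj₂ (inj₂ (inj₂ e))

divisors-10 : ∀ {q} → q ∣ 10 → q ≡ 1 ⊎ q ≡ 2 ⊎ q ≡ 5 ⊎ q ≡ 10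
divisors-10 q∣ with divisors 9 q∣
... | here e                         = inj₁ e
... | there (here e)                 = inj₂ (inj₁ e)
... | there (there (here e))         = inj₂ (inj₂ (inj₁ e))
... | there (there (there (here e))) = inj₂ (inj₂ (inj₂ e))

-- The conformists: constancy of the energy and pivotal flips.

-- X t i is the opinion of the conformist i, β i tells whether i is a neighbour of the nonconformist.
module Conformists {m}
  (a : Fin m → Fin m → Bool) (a-sym : ∀ i j → a i j ≡ a j i)
  (β : Fin m → Bool) (loop : Bool) (ρ : Fin m → ℤ) (ρ₁ : ℤ)
  (X : ℕ → Fin m → Bool) (c : ℕ → Bool)
  (X-step : ∀ i t → X (suc t) i ≡ does (ρ i ≤? χ (β i ∧ c t) + sum (λ j → χ (a i j ∧ X t j))))
  (c-step : ∀ t → c (suc t) ≡ does (χ (loop ∧ c t) + sum (λ j → χ (β j ∧ X t j)) <? ρ₁))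
  (p : ℕ) (X-period : ∀ t → X (suc p ℕ.+ t) ≡ X t) (c-period : ∀ t → c (suc p ℕ.+ t) ≡ c t)
  where

  open SymmetricForm a a-sym (λ i → χ (β i) + 1ℤ - (ρ i + ρ i))

  M : Fin m → ℕ → ℤ
  M i t = field-at (X t) i

  step-up : ∀ i t → X (suc t) i ≡ true → ρ i ≤ χ (β i ∧ c t) + M i t
  step-up i t e = does⇒ (ρ i ≤? _) (trans (sym (X-step i t)) e)

  step-down : ∀ i t → X (suc t) i ≡ false → χ (β i ∧ c t) + M i t < ρ i
  step-down i t e = ≰⇒> (does⇒¬ (ρ i ≤? _) (trans (sym (X-step i t)) e))

  slack-nonneg : ∀ i t x → X (suc t) i ≡ x → 0ℤ ≤ slack (β i) (M i t) (ρ i) x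
  slack-nonneg i t true e = i≤j⇒0≤j-i
    (≤-trans (step-up i t e) (+-monoˡ-≤ (M i t) (χ-mono (proj₁ ∘ ∧-true))))
  slack-nonneg i t false e = i≤j⇒0≤j-i
    (i<j⇒i≤pred[j]′ (≤-<-trans (i≤j+i (M i t) (χ (β i ∧ c t))) (step-down i t e)))
    where
    i<j⇒i≤pred[j]′ : ∀ {i j} → i < j → i ≤ j - 1ℤ
    i<j⇒i≤pred[j]′ {i} {j} i<j = ≤-trans (i<j⇒i≤pred[j] i<j) (≤-reflexive (+-comm ℤ.-1ℤ j))

  Δ : ℕ → Fin m → ℤ
  Δ t = gain (X t) (X (suc t)) (X (2 ℕ.+ t))

  0≤1-χ : ∀ b → 0ℤ ≤ 1ℤ - χ b
  0≤1-χ false = ℤ.+≤+ z≤n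
  0≤1-χ true  = ≤-refl

  Δ-flip : ∀ i t x → X (2 ℕ.+ t) i ≡ x → X t i ≡ not x →
    let s = slack (β i) (M i (suc t)) (ρ i) x in Δ t i ≡ s + s + (1ℤ - χ (β i))
  Δ-flip i t x e₂ e₀ rewrite e₂ | e₀ = slack-gain (β i) (M i (suc t)) (ρ i) x

  Δ-stay : ∀ i t → X (2 ℕ.+ t) i ≡ X t i → Δ t i ≡ 0ℤ
  Δ-stay i t e rewrite e | +-inverseʳ (χ (X t i)) = refl

  Δ-nonneg : ∀ t i → 0ℤ ≤ Δ t i
  Δ-nonneg t i with X (2 ℕ.+ t) i ≟ X t i
  ... | yes e = ≤-reflexive (sym (Δ-stay i t e))
  ... | no ¬e = subst (0ℤ ≤_) (sym (Δ-flip i t x refl (≢⇒not ¬e)))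
                  (+-mono-≤ (+-mono-≤ s≥0 s≥0) (0≤1-χ (β i)))
    where
    x = X (2 ℕ.+ t) i
    s≥0 = slack-nonneg i (suc t) x refl

  Δ-sum : ∀ t → sum (Δ t) ≤ 0ℤ
  Δ-sum = periodic-increments-vanish
    (λ t → energy (X (suc t)) (X t)) (sum ∘ Δ) p
    (λ t → cong₂ energy (trans (cong X (sym (ℕ.+-suc (suc p) t))) (X-period (suc t))) (X-period t))
    (λ t → energy-gain (X t) (X (suc t)) (X (2 ℕ.+ t)))
    (λ t → ≤-trans (≤-reflexive (sym (sum-replicate-zero m))) (sum-mono (Δ-nonneg t)))

  Δ-vanishes : ∀ t i → 0ℤ ≡ Δ t i
  Δ-vanishes t = sum-mono-≡ (Δ-nonneg t) (≤-trans (Δ-sum t) (≤-reflexive (sym (sum-replicate-zero m))))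

  vanishing-slack : ∀ {s} b → 0ℤ ≤ s → 0ℤ ≡ s + s + (1ℤ - χ b) → s ≡ 0ℤ × b ≡ true
  vanishing-slack {+ zero}  true  _ _ = refl , refl
  vanishing-slack {+ suc n} true  _ ()
  vanishing-slack {+ zero}  false _ ()
  vanishing-slack {+ suc n} false _ ()

  -- The gain of a flip is twice a nonnegative slack plus the nonnegative `1ℤ - χ (β i)`. As the
  -- gain vanishes, both parts do: the conformist sees the nonconformist, and without it misses the
  -- threshold by exactly one.
  flip-pivotal : ∀ i t x → X (2 ℕ.+ t) i ≡ x → X t i ≡ not x →
    ρ i ≡ 1ℤ + M i (suc t) × β i ≡ true
  flip-pivotal i t x e₂ e₀ = pivot x (proj₁ vanishing) , proj₂ vanishing
    where
    open ≡-Reasoning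
    μ = M i (suc t)
    vanishing = vanishing-slack (β i) (slack-nonneg i (suc t) x e₂)
                  (trans (Δ-vanishes t i) (Δ-flip i t x e₂ e₀))
    pivot : ∀ x → slack (β i) μ (ρ i) x ≡ 0ℤ → ρ i ≡ 1ℤ + μ
    pivot true  s≡0 = begin
      ρ i           ≡⟨ i-j≡0⇒i≡j (χ (β i) + μ) (ρ i) s≡0 ⟨
      χ (β i) + μ   ≡⟨ cong (λ b → χ b + μ) (proj₂ vanishing) ⟩
      1ℤ + μ        ∎
    pivot false s≡0 = begin
      ρ i               ≡⟨ lemma (ρ i) ⟩
      1ℤ + (ρ i - 1ℤ)   ≡⟨ cong (λ z → 1ℤ + z) (i-j≡0⇒i≡j (ρ i - 1ℤ) μ s≡0) ⟩
      1ℤ + μ            ∎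
      where
      lemma : ∀ k → k ≡ 1ℤ + (k - 1ℤ)
      lemma = solve-∀

  -- The opinion x is adopted whatever the nonconformist does.
  Strong : Bool → Fin m → ℕ → Set
  Strong true  i t = ρ i ≤ M i t
  Strong false i t = χ (β i) + M i t < ρ i

  strong⇒next : ∀ x i t → Strong x i t → X (suc t) i ≡ x
  strong⇒next true  i t s = trans (X-step i t)
    (dec-true (_ ≤? _) (≤-trans s (i≤j+i (M i t) (χ (β i ∧ c t)))))
  strong⇒next false i t s = trans (X-step i t)
    (dec-false (_ ≤? _) (<⇒≱ (≤-<-trans (+-monoˡ-≤ (M i t) (χ-mono (proj₁ ∘ ∧-true))) s)))

  -- A strong conformist holds `x` one step later. Had it held the other opinion one step earlier,
  -- it would have flipped and so be pivotal, which is incompatible with strength.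
  strong⇒previous : ∀ x i t → Strong x i (suc t) → X t i ≡ x
  strong⇒previous x i t s with X t i ≟ x
  ... | yes e = e
  ... | no ¬e = contradiction s (not-strong x)
    where
    pivotal = flip-pivotal i t x (strong⇒next x i (suc t) s) (¬-not ¬e)
    not-strong : ∀ x → ¬ Strong x i (suc t)
    not-strong true  s = <⇒≱ (suc[i]≤j⇒i<j (≤-reflexive (sym (proj₁ pivotal)))) s
    not-strong false s = <-irrefl (trans (cong (λ b → χ b + M i (suc t)) (proj₂ pivotal)) (sym (proj₁ pivotal))) s

  -- An opinion adopted against the nonconformist would also be adopted with its support.
  opposed⇒strong : ∀ x i t → c t ≡ not x → X (suc t) i ≡ x → Strong x i t
  opposed⇒strong true i t ct e = subst (ρ i ≤_)
    (trans (cong (λ z → χ z + M i t) (trans (cong (β i ∧_) ct) (∧-zeroʳ (β i)))) (+-identityˡ (M i t)))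
    (step-up i t e)
  opposed⇒strong false i t ct e = subst (_< ρ i)
    (cong (λ z → χ z + M i t) (trans (cong (β i ∧_) ct) (∧-identityʳ (β i))))
    (step-down i t e)

  -- Rules for inclusions between the sets of conformists.

  -- Inclusion of the sets of conformists holding opinion x.  Times of equal parity are required
  -- because a conformist who does not see the nonconformist may oscillate with period 2.
  record Le (x : Bool) (s t : ℕ) : Set where
    constructor le
    field
      parity : even s ≡ even t
      incl   : ∀ i → X s i ≡ x → X t i ≡ x
  open Le

  Le-refl : ∀ {x t} → Le x t t
  Le-refl = le refl λ _ e → e

  Le-trans : ∀ {x s t u} → Le x s t → Le x t u → Le x s u
  Le-trans (le p f) (le q g) = le (trans p q) λ i → g i ∘ f i

  Le-not : ∀ {x s t} → Le x s t → Le (not x) t s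
  Le-not (le p f) = le (sym p) λ i e → ¬-not λ e′ → not-¬ (f i e′) e

  Le-not⁻¹ : ∀ {x s t} → Le (not x) s t → Le x t s
  Le-not⁻¹ {x} l = subst (λ y → Le y _ _) (not-involutive x) (Le-not l)

  Le-true⇒≤ : ∀ (w : Fin m → Bool) {s t} → Le true s t → ∀ i → χ (w i ∧ X s i) ≤ χ (w i ∧ X t i)
  Le-true⇒≤ w l i = χ-mono λ e → let w≡ , x≡ = ∧-true e in cong₂ _∧_ w≡ (incl l i x≡)

  strong-mono : ∀ x i {s t} → Le x s t → Strong x i s → Strong x i t
  strong-mono true  i l s = ≤-trans s (sum-mono (Le-true⇒≤ (a i) l))
  strong-mono false i l s =
    ≤-<-trans (+-monoʳ-≤ (χ (β i)) (sum-mono (Le-true⇒≤ (a i) (Le-not l)))) s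

  -- Whoever holds `x` at s + 1 adopted it against the nonconformist, hence is strong for `x` at s,
  -- and by the inclusion also at t.
  down : ∀ {x s t} → c s ≡ not x → Le x s t → Le x (suc s) (suc t)
  down {x} {s} {t} cs l = le (cong not (parity l)) λ i e →
    strong⇒next x i t (strong-mono x i l (opposed⇒strong x i s cs e))

  -- As for `down`, but strength at t + 1 is exploited backwards in time, through `strong⇒previous`.
  down′ : ∀ {x s t} → c s ≡ not x → Le x s (suc t) → Le x (suc s) t
  down′ {x} {s} {t} cs l = le (trans (cong not (parity l)) (not-involutive (even t))) λ i e →
    strong⇒previous x i t (strong-mono x i l (opposed⇒strong x i s cs e))

  up : ∀ {x s t} → c t ≡ x → Le x s t → Le x (suc s) (suc t)
  up {x} ct l = Le-not⁻¹ (down (trans ct (sym (not-involutive x))) (Le-not l))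

  up′ : ∀ {x s t} → c t ≡ x → Le x (suc s) t → Le x s (suc t)
  up′ {x} ct l = Le-not⁻¹ (down′ (trans ct (sym (not-involutive x))) (Le-not l))

  -- A change over two steps would be pivotal, and a pivotal conformist sees the nonconformist.
  unseen-period-2 : ∀ i → β i ≡ false → ∀ t → X (2 ℕ.+ t) i ≡ X t i
  unseen-period-2 i β≡ t with X (2 ℕ.+ t) i ≟ X t i
  ... | yes e = e
  ... | no ¬e = contradiction (trans (sym β≡) (proj₂ (flip-pivotal i t _ refl (≢⇒not ¬e)))) λ ()

  unseen-parity : ∀ i → β i ≡ false → ∀ {s t} → even s ≡ even t → X s i ≡ X t i
  unseen-parity i β≡ {s} {t} e = trans (reduce s) (trans (cong at e) (sym (reduce t)))
    where
    at : Bool → Bool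
    at b = X (if b then 0 else 1) i
    reduce : ∀ t → X t i ≡ at (even t)
    reduce zero          = refl
    reduce (suc zero)    = refl
    reduce (suc (suc t)) = trans (unseen-period-2 i β≡ t)
      (trans (reduce t) (cong at (sym (not-involutive (even t)))))

  -- By the inclusion v₁ has at t at least as many conformist neighbours of opinion +1 as at s, yet
  -- the anti-threshold rule requires a smaller total count at t. Only the loop can account for
  -- this, and only by one unit, so the two numbers are equal. Then the neighbours of v₁ agree one
  -- by one, and the other conformists agree by parity.
  Le-threshold : ∀ {s t} → Le true s t → c (suc s) ≡ false → c (suc t) ≡ true →
    Le true t s × c s ≡ true × c t ≡ false × loop ≡ true
  Le-threshold {s} {t} l cs ct =
    le (sym (parity l)) back , proj₂ s-counted ,
    subst (λ l → l ∧ c t ≡ false) (proj₁ s-counted) (proj₁ dropped) , proj₁ s-counted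
    where
    N : ℕ → ℤ
    N t = sum λ j → χ (β j ∧ X t j)
    dropped : loop ∧ c t ≡ false × loop ∧ c s ≡ true × N t ≤ N s
    dropped = χ-shift-< (loop ∧ c t) (loop ∧ c s)
      (<-≤-trans (does⇒ (_ <? ρ₁) (trans (sym (c-step t)) ct))
                 (≮⇒≥ (does⇒¬ (_ <? ρ₁) (trans (sym (c-step s)) cs))))
      (sum-mono (Le-true⇒≤ β l))
    s-counted = ∧-true (proj₁ (proj₂ dropped))
    seen : ∀ i → β i ≡ true → X s i ≡ X t i
    seen i β≡ = subst (λ b → b ∧ X s i ≡ b ∧ X t i) β≡
      (χ-injective (sum-mono-≡ (Le-true⇒≤ β l) (proj₂ (proj₂ dropped)) i))
    same : ∀ i b → β i ≡ b → X s i ≡ X t i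
    same i false β≡ = unseen-parity i β≡ (parity l)
    same i true  β≡ = seen i β≡
    back : ∀ i → X t i ≡ true → X s i ≡ true
    back i = trans (same i (β i) refl)

  threshold : ∀ {x s t} → Le x s t → c (suc s) ≡ not x → c (suc t) ≡ x →
    Le x t s × c s ≡ x × c t ≡ not x × loop ≡ true
  threshold {true}  l cs ct = Le-threshold l cs ct
  threshold {false} l cs ct =
    let l′ , ct′ , cs′ , looped = Le-threshold (Le-not l) ct cs
    in Le-not l′ , cs′ , ct′ , looped

  -- The inclusions chain along t, L + t, 2L + t and so on; after `suc p` rounds the chain is back
  -- at the state of time t.
  monotone-recurrence : ∀ {x} L t → (∀ k → Le x (k ℕ.* L ℕ.+ t) (L ℕ.+ (k ℕ.* L ℕ.+ t))) →
    ∀ i → X (L ℕ.+ t) i ≡ X t i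
  monotone-recurrence {x} L t grow i with X t i ≟ x
  ... | yes e = trans (incl (grow 0) i e) (sym e)
  ... | no ¬e = trans (¬-not (¬e ∘ later⇒now)) (sym (¬-not ¬e))
    where
    τ : ℕ → ℕ
    τ k = k ℕ.* L ℕ.+ t
    chain : ∀ k → Le x (L ℕ.+ t) (τ (suc k))
    chain zero    = subst (λ n → Le x (L ℕ.+ t) (n ℕ.+ t)) (sym (ℕ.+-identityʳ L)) Le-refl
    chain (suc k) = Le-trans (chain k)
      (subst (Le x (τ (suc k))) (sym (ℕ.+-assoc L (suc k ℕ.* L) t)) (grow (suc k)))
    later⇒now : X (L ℕ.+ t) i ≡ x → X t i ≡ x
    later⇒now e = trans (sym (cong (λ f → f i) (iterate-period X X-period L t)))
      (trans (cong (λ n → X (n ℕ.+ t) i) (ℕ.*-comm L (suc p))) (incl (chain p) i e))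

  -- Exclusion of factors and inclusions along words.

  open Windows c

  -- The loop exception in `threshold` demands `c s ≡ x`, so the opposite letter at s rules out even
  -- this exception.
  clash-below : ∀ {x s t} → Le x s t → c (suc s) ≡ not x → c (suc t) ≡ x → c s ≡ not x → ⊥
  clash-below l cs ct ¬c = not-¬ (proj₁ (proj₂ (threshold l cs ct))) ¬c

  clash-above : ∀ {x s t} → Le x s t → c (suc s) ≡ not x → c (suc t) ≡ x → c t ≡ x → ⊥
  clash-above l cs ct c≡ = not-¬ c≡ (proj₁ (proj₂ (proj₂ (threshold l cs ct))))

  -- The proofs of this group work by reflection, with times counted from the start of the factor. A
  -- run of l letters `O` beginning at time k gives, by l uses of `down′`, the inclusion of time k +
  -- l in time k - l; a run of `I` gives the reverse inclusion by `up′`. The letters following the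
  -- two times then clash.
  no-10100 : Never (I ∷ O ∷ I ∷ O ∷ O ∷ [])
  no-10100 _ _ (h0 , h1 , h2 , h3 , h4 , _) = clash-below (up h0 (down′ h1 Le-refl)) h4 h2 h3

  no-110000 : Never (I ∷ I ∷ O ∷ O ∷ O ∷ O ∷ [])
  no-110000 _ _ (_ , h1 , h2 , h3 , h4 , h5 , _) = clash-below (down′ h3 (down′ h2 Le-refl)) h5 h1 h4

  no-110010 : Never (I ∷ I ∷ O ∷ O ∷ I ∷ O ∷ [])
  no-110010 _ _ (h0 , h1 , h2 , h3 , _ , h5 , _) = clash-above (down′ h3 (down′ h2 Le-refl)) h5 h1 h0

  no-101111 : Never (I ∷ O ∷ I ∷ I ∷ I ∷ I ∷ [])
  no-101111 _ _ (_ , h1 , h2 , h3 , h4 , h5 , _) = clash-above (up′ h3 (up′ h2 Le-refl)) h1 h5 h4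

  no-1011000 : Never (I ∷ O ∷ I ∷ I ∷ O ∷ O ∷ O ∷ [])
  no-1011000 _ _ (h0 , h1 , h2 , _ , h4 , h5 , h6 , _) =
    clash-below (Le-trans (down′ h4 Le-refl) (up h0 (down′ h1 Le-refl))) h6 h2 h5

  no-10110111 : Never (I ∷ O ∷ I ∷ I ∷ O ∷ I ∷ I ∷ I ∷ [])
  no-10110111 _ _ (_ , h1 , h2 , h3 , _ , h5 , h6 , h7 , _) =
    clash-above (Le-trans (up′ h3 (up′ h2 Le-refl)) (up′ h5 Le-refl)) h1 h7 h6

  no-101101100 : Never (I ∷ O ∷ I ∷ I ∷ O ∷ I ∷ I ∷ O ∷ O ∷ [])
  no-101101100 _ _ (h0 , h1 , h2 , h3 , h4 , h5 , _ , h7 , h8 , _) =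
    clash-below (up h0 (Le-trans (up h3 (down′ h4 Le-refl)) 4≤0)) h8 h2 h7
    where
    -- Reflection includes time 0 in time 4. Letters 1 and 5 leave only the loop exception, in which
    -- the two sets coincide, so the inclusion can be reversed.
    4≤0 = proj₁ (threshold (up′ h3 (up′ h2 Le-refl)) h1 h5)

  no-11100010 : Never (I ∷ I ∷ I ∷ O ∷ O ∷ O ∷ I ∷ O ∷ [])
  no-11100010 _ _ (h0 , h1 , _ , h3 , h4 , h5 , _ , h7 , _) =
    clash-above (down′ h5 (down′ h4 (down′ h3 Le-refl))) h7 h1 h0

  no-111000110 : Never (I ∷ I ∷ I ∷ O ∷ O ∷ O ∷ I ∷ I ∷ O ∷ [])
  no-111000110 _ _ (h0 , h1 , h2 , h3 , h4 , h5 , _ , _ , h8 , _) =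
    clash-above (up h0 (down′ h5 (down′ h4 (down′ h3 Le-refl)))) h8 h2 h1

  no-110011000 : Never (I ∷ I ∷ O ∷ O ∷ I ∷ I ∷ O ∷ O ∷ O ∷ [])
  no-110011000 _ _ (h0 , h1 , h2 , h3 , h4 , _ , h6 , h7 , h8 , _) =
    clash-below (down h6 (up h1 (up h0 (down′ h3 (down′ h2 Le-refl))))) h8 h4 h7

  no-1001110111 : Never (I ∷ O ∷ O ∷ I ∷ I ∷ I ∷ O ∷ I ∷ I ∷ I ∷ [])
  no-1001110111 _ _ (_ , h1 , _ , h3 , h4 , h5 , _ , h7 , h8 , h9 , _) =
    clash-above (Le-trans (up′ h5 (up′ h4 (up′ h3 Le-refl))) (up′ h7 Le-refl)) h1 h9 h8

  no-101110011101 : Never (I ∷ O ∷ I ∷ I ∷ I ∷ O ∷ O ∷ I ∷ I ∷ I ∷ O ∷ I ∷ [])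
  no-101110011101 _ _ (h0 , h1 , h2 , h3 , h4 , _ , _ , h7 , h8 , h9 , h10 , h11 , _) =
    clash-above (Le-trans (up′ h0 (proj₁ (threshold 0≤10 h1 h11))) (up′ h2 Le-refl)) h10 h4 h3
    where
    -- Reflection leads from 1 to 5 and from 5 to 9, and letter 9 widens this to times 0 and 10.
    -- Letters 1 and 11 then allow it to be reversed.
    0≤10 = up′ h9 (Le-trans (up′ h4 (up′ h3 Le-refl)) (up′ h8 (up′ h7 Le-refl)))

  no-110001100010 : Never (I ∷ I ∷ O ∷ O ∷ O ∷ I ∷ I ∷ O ∷ O ∷ O ∷ I ∷ O ∷ [])
  no-110001100010 _ _ (h0 , h1 , _ , h3 , h4 , _ , _ , h7 , h8 , h9 , _ , h11 , _) =
    clash-above (down′ h9 (Le-trans (down′ h8 (down′ h7 Le-refl)) (down′ h4 (down′ h3 Le-refl)))) h11 h1 h0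

  never-factors : All Never factors
  never-factors =
    no-10100 ∷ no-110000 ∷ no-110010 ∷ no-101111 ∷ no-1011000 ∷ no-10110111 ∷
    no-101101100 ∷ no-11100010 ∷ no-111000110 ∷ no-110011000 ∷ no-1001110111 ∷
    no-101110011101 ∷ no-110001100010 ∷ []

  -- Letters 1 and 3 are just those of the loop exception in `threshold`, so it is the absence of
  -- the loop that gives the contradiction.
  no-10110 : loop ≡ false → Never (I ∷ O ∷ I ∷ I ∷ O ∷ [])
  no-10110 loopless _ _ (h0 , h1 , h2 , h3 , h4 , _) = contradiction
    (trans (sym loopless) (proj₂ (proj₂ (proj₂ (threshold (up h0 (down′ h1 Le-refl)) h4 h2))))) λ ()

  -- If `c` has period `d`, the inclusion recurs at every round, and `monotone-recurrence` makes it
  -- an equality. Since `Le` preserves parity, `d` has to be even: words of period 3 and 5 are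
  -- traversed twice, whence the alternatives 6 and 10.
  Advances : ℕ → Word → Set
  Advances d f = ∀ {x t} → Spells x f t → Le x t (d ℕ.+ t)

  advances-11 : Advances 2 (I ∷ I ∷ [])
  advances-11 (_ , h1 , _) = up′ h1 Le-refl

  advances-01 : Advances 2 (O ∷ I ∷ [])
  advances-01 (_ , h1 , _) = up′ h1 Le-refl

  advances-0011 : Advances 4 (O ∷ O ∷ I ∷ I ∷ [])
  advances-0011 (_ , _ , h2 , h3 , _) = up′ h3 (up′ h2 Le-refl)

  advances-000111 : Advances 6 (O ∷ O ∷ O ∷ I ∷ I ∷ I ∷ [])
  advances-000111 (_ , _ , _ , h3 , h4 , h5 , _) = up′ h5 (up′ h4 (up′ h3 Le-refl))

  advances-1011 : Advances 4 (I ∷ O ∷ I ∷ I ∷ [])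
  advances-1011 (_ , _ , h2 , h3 , _) = up′ h3 (up′ h2 Le-refl)

  -- The run of three `I` reflects 0 into 6, and the run of two reflects 6 into 10.
  advances-1001110011 : Advances 10 (I ∷ O ∷ O ∷ I ∷ I ∷ I ∷ O ∷ O ∷ I ∷ I ∷ [])
  advances-1001110011 (_ , _ , _ , h3 , h4 , h5 , _ , _ , h8 , h9 , _) =
    Le-trans (up′ h5 (up′ h4 (up′ h3 Le-refl))) (up′ h9 (up′ h8 Le-refl))

  -- The run of two `O` includes 4 in 0, the wrong direction; letters 5 and 1 force the loop
  -- exception, which reverses it. The last letters lead from 4 to 6.
  advances-010010 : Advances 6 (O ∷ I ∷ O ∷ O ∷ I ∷ O ∷ [])
  advances-010010 (_ , h1 , h2 , h3 , h4 , h5 , _) =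
    Le-trans (proj₁ (threshold (down′ h3 (down′ h2 Le-refl)) h5 h1)) (down h3 (up′ h4 Le-refl))

  advances-01100010 : Advances 8 (O ∷ I ∷ I ∷ O ∷ O ∷ O ∷ I ∷ O ∷ [])
  advances-01100010 (_ , h1 , _ , h3 , h4 , h5 , h6 , h7 , _) =
    Le-trans (proj₁ (threshold (down′ h5 (down′ h4 (down′ h3 Le-refl))) h7 h1)) (down h5 (up′ h6 Le-refl))

  -- Classification of the word and of the period.

  open Recurrent p c-period

  Classified : Set
  Classified = Cases1to8 c (suc p) × (loop ≡ false → Cases1to6 c (suc p))

  module _ (returns : ∀ d t → c (d ℕ.+ t) ≡ c t → (∀ i → X (d ℕ.+ t) i ≡ X t i) → suc p ∣ d) where

    period-advances : ∀ d f → Advances d f → (∀ t → c (d ℕ.+ t) ≡ c t) →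
      (∃ λ x → ∃ λ t → Spells x f t) → suc p ∣ d
    period-advances d f advances e (x , t , spells) =
      returns d t (e t) (monotone-recurrence d t λ k → advances (Spells-multiple k))
      where
      Spells-multiple : ∀ k → Spells x f (k ℕ.* d ℕ.+ t)
      Spells-multiple zero    = spells
      Spells-multiple (suc k) =
        subst (Spells x f) (sym (ℕ.+-assoc d (k ℕ.* d) t)) (Spells-shift e f (Spells-multiple k))

    unlooped : Cases1to6 c (suc p) → Classified
    unlooped k = inj₁ k , λ _ → k

    open Excluding

    not-2-periodic : NeverLag constant → NeverLag alternating → ¬ (∀ t → c (2 ℕ.+ t) ≡ c t)
    not-2-periodic ¬const ¬alt e with c 1 ≟ c 0
    ... | yes e₀ = ¬const 0 (e₀ , trans (e 0) (sym e₀) , trans (e 1) (trans e₀ (sym (e 0))) , tt)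
    ... | no ¬e₀ = ¬alt 0
        (¬e , trans (e 0) (sym (trans (cong not ¬e) (not-involutive (c 0)))) ,
         trans (e 1) (trans ¬e (cong not (sym (e 0)))) , tt)
      where
      ¬e = ¬-not ¬e₀

    antiperiod-doubled : ∀ d → (∀ t → c (d ℕ.+ t) ≡ not (c t)) → ∀ t → c (d ℕ.+ (d ℕ.+ t)) ≡ c t
    antiperiod-doubled d e t = trans (e (d ℕ.+ t)) (trans (cong not (e t)) (not-involutive (c t)))

    cycle : ∀ ls → All NeverLag ls → ∀ {L} (s : Bool → Vec Bool (suc L)) f →
      (∀ t → c (suc L ℕ.+ t) ≡ c t) → ∀ σ d → (∀ t → c (d ℕ.+ t) ≡ c t · σ) →
      T (explore (excluding factors ls) (cycling s f σ d) 15 []) → T (suc L ℕ.≤ᵇ 15) →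
      ∀ k → Advances (k ℕ.* suc L) f → (∃ λ x → Repeats (s x) c) × suc p ∣ k ℕ.* suc L
    cycle ls ¬ls s f period-c σ d e h L≤ k advances = proj₁ repetition ,
      period-advances _ f advances (iterate-period c period-c k) (proj₂ repetition)
      where
      repetition = cyclic never-factors ls ¬ls s f period-c σ d e h L≤

    period-is : ∀ {q} → suc p ≡ q → ∀ t → c (q ℕ.+ t) ≡ c t
    period-is refl = c-period

    case-I : (∀ t → c (suc t) ≡ c t) → CaseI c (suc p)
    case-I e = const , divisors-2 (period-advances 2 (I ∷ I ∷ []) advances-11 (λ t → trans (e (suc t)) (e t))
      (c 0 , 0 , refl , e 0 , tt))
      where
      const : Constant c
      const zero    = refl
      const (suc t) = trans (e t) (const t)

    case-II : (∀ t → c (suc t) ≡ not (c t)) → CaseII c (suc p)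
    case-II e = e , [ (λ p≡1 → contradiction (e 0) (not-¬ (period-is p≡1 0))) , id ]′
      (divisors-2 (period-advances 2 (O ∷ I ∷ []) advances-01 (antiperiod-doubled 1 e)
        (not (c 0) , 0 , sym (not-involutive (c 0)) , e 0 , tt)))

    module Nontrivial (¬constant : NeverLag constant) (¬alternating : NeverLag alternating) where

      p≢1 : ¬ suc p ≡ 1
      p≢1 p≡1 = not-2-periodic ¬constant ¬alternating (iterate-period c (period-is p≡1) 2)

      p≢2 : ¬ suc p ≡ 2
      p≢2 p≡2 = not-2-periodic ¬constant ¬alternating (period-is p≡2)

      ¬trivial : All NeverLag stage₂
      ¬trivial = ¬alternating ∷ ¬constant ∷ []

      large : ∀ {A : Set} → suc p ≡ 1 ⊎ suc p ≡ 2 ⊎ A → A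
      large = [ ⊥-elim ∘ p≢1 , [ ⊥-elim ∘ p≢2 , id ]′ ]′

      case-III : (∀ t → c (2 ℕ.+ t) ≡ not (c t)) → CaseIII c (suc p)
      case-III e = Product.map proj₂ (large ∘ divisors-4)
        -- Exchanging the opinions only shifts this word, so one pattern serves both values of x.
        (cycle stage₂ ¬trivial (λ _ → true ∷ true ∷ false ∷ false ∷ []) (O ∷ O ∷ I ∷ I ∷ []) (antiperiod-doubled 2 e)
          false 2 e tt tt 1 advances-0011)

      case-IV : (∀ t → c (3 ℕ.+ t) ≡ not (c t)) → CaseIV c (suc p)
      case-IV e = Product.map proj₂
        ([ (λ p≡3 → contradiction (e 0) (not-¬ (period-is p≡3 0))) , id ]′ ∘ large ∘ divisors-6)
        (cycle stage₂ ¬trivial (λ _ → true ∷ true ∷ true ∷ false ∷ false ∷ false ∷ []) (O ∷ O ∷ O ∷ I ∷ I ∷ I ∷ [])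
          (antiperiod-doubled 3 e) false 3 e tt tt 1 advances-000111)

      -- Antiperiod 2 entails period 4, so the words of case III have to be set aside first.
      case-V : NeverLag antiperiod-2 → (∀ t → c (4 ℕ.+ t) ≡ c t) → CaseV c (suc p)
      case-V ¬anti e =
        let (x , rep) , p∣4 = cycle (antiperiod-2 ∷ stage₂) (¬anti ∷ ¬trivial) (λ x → x ∷ x ∷ x ∷ not x ∷ [])
              (I ∷ O ∷ I ∷ I ∷ []) e true 4 e tt tt 1 advances-1011
        in x , rep , large (divisors-4 p∣4)

      case-VI : (∀ t → c (5 ℕ.+ t) ≡ c t) → CaseVI c (suc p)
      case-VI e =
        let (x , rep) , p∣10 = cycle stage₂ ¬trivial (λ x → x ∷ x ∷ x ∷ not x ∷ not x ∷ [])
              (I ∷ O ∷ O ∷ I ∷ I ∷ I ∷ O ∷ O ∷ I ∷ I ∷ []) e true 5 e tt tt 2 advances-1001110011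
        in x , rep , large (divisors-10 p∣10)

      case-VII : (∀ t → c (3 ℕ.+ t) ≡ c t) → CaseVII c (suc p)
      case-VII e =
        let (x , rep) , p∣6 = cycle stage₂ ¬trivial (λ x → x ∷ not x ∷ not x ∷ [])
              (O ∷ I ∷ O ∷ O ∷ I ∷ O ∷ []) e true 3 e tt tt 2 advances-010010
        in x , rep , large (divisors-6 p∣6)

      -- Without a loop at v₁ the factor of `no-10110` is excluded too, and the enlarged search
      -- contradicts the shape of the word.
      looped : ∀ ls → All NeverLag ls → ∀ n good →
        T (explore (excluding ((I ∷ O ∷ I ∷ I ∷ O ∷ []) ∷ factors) ls) good n []) →
        ¬ T (good (window n 0)) → ¬ loop ≡ false
      looped ls ¬ls n good h ¬good loopless =
        ¬good (everywhere (no-10110 loopless ∷ never-factors) ls ¬ls good n h 0)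

      case-VII-looped : (∀ t → c (3 ℕ.+ t) ≡ c t) → ¬ loop ≡ false
      case-VII-looped e = looped stage₂ ¬trivial 11 (not ∘ lagged (lag true 3 8)) tt
        λ h → T-not h (lagged-complete (lag true 3 8) 11 0 ℕ.≤-refl (always-lagged true 3 8 e 0))

      case-VIII : All NeverLag stage₇ → CaseVIII c (suc p)
      case-VIII ¬ls =
        let (x , rep) , p∣8 = cycle stage₇ ¬ls
              (λ x → x ∷ not x ∷ not x ∷ x ∷ x ∷ not x ∷ not x ∷ not x ∷ [])
              (O ∷ I ∷ I ∷ O ∷ O ∷ O ∷ I ∷ O ∷ []) period-8 true 8 period-8 tt tt 1 advances-01100010
        in x , rep , [ ⊥-elim ∘ p≢4 , id ]′ (large (divisors-8 p∣8))
        where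
        later : ∀ t → c (9 ℕ.+ t) ≡ c (suc t)
        later t = proj₁ (lagged-sound (lag true 8 1) 11 (suc t)
          (everywhere never-factors stage₇ ¬ls (lagged (lag true 8 1) ∘ drop 1) 12 tt t))
        period-8 : ∀ t → c (8 ℕ.+ t) ≡ c t
        -- The first letter of the window in `later` is mere context, so `later` begins at time 1;
        -- recurrence carries it to time 0.
        period-8 t = trans (sym (c-period (8 ℕ.+ t)))
          (trans (cong c (ℕ.+-comm (suc p) (8 ℕ.+ t))) (trans (cong (λ n → c (8 ℕ.+ n)) (ℕ.+-comm t (suc p)))
            (trans (later (p ℕ.+ t)) (c-period t))))
        p≢4 : ¬ suc p ≡ 4
        p≢4 p≡4 = All.head ¬ls 0 (always-lagged true 4 4 (period-is p≡4) 0)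

      -- With the extra factor excluded no word of length 13 survives, so the search succeeds even
      -- for the predicate that is constantly false.
      case-VIII-looped : All NeverLag stage₇ → ¬ loop ≡ false
      case-VIII-looped ¬ls = looped stage₇ ¬ls 13 (λ _ → false) tt id

      -- The stages are antiperiod 3, period 3, antiperiod 2, period 5, period 4 and the remainder.
      -- The last number passed to each is one less than the range of its lag, and `tt` certifies
      -- the evaluated search.
      nontrivial : Classified
      nontrivial =
        [ unlooped ∘ inj₂ ∘ inj₂ ∘ inj₂ ∘ inj₁ ∘ case-IV , (λ ¬3 →
        [ (λ e → inj₂ (inj₁ (case-VII e)) , ⊥-elim ∘ case-VII-looped e) , (λ ¬4 →
        [ unlooped ∘ inj₂ ∘ inj₂ ∘ inj₁ ∘ case-III , (λ ¬5 →
        [ unlooped ∘ inj₂ ∘ inj₂ ∘ inj₂ ∘ inj₂ ∘ inj₂ ∘ case-VI , (λ ¬6 →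
        [ unlooped ∘ inj₂ ∘ inj₂ ∘ inj₂ ∘ inj₂ ∘ inj₁ ∘ case-V ¬5 , (λ ¬7 →
          let ¬ls = ¬7 ∷ ¬6 ∷ ¬5 ∷ ¬4 ∷ ¬3 ∷ ¬trivial in
          inj₂ (inj₂ (case-VIII ¬ls)) , ⊥-elim ∘ case-VIII-looped ¬ls)
        ]′ (co-persistent-stage never-factors stage₆ (¬6 ∷ ¬5 ∷ ¬4 ∷ ¬3 ∷ ¬trivial) true 4 3 tt))
        ]′ (persistent-stage never-factors stage₅ (¬5 ∷ ¬4 ∷ ¬3 ∷ ¬trivial) true 5 4 tt))
        ]′ (persistent-stage never-factors stage₄ (¬4 ∷ ¬3 ∷ ¬trivial) false 2 5 tt))
        ]′ (persistent-stage never-factors stage₃ (¬3 ∷ ¬trivial) true 3 3 tt))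
        ]′ (persistent-stage never-factors stage₂ ¬trivial false 3 4 tt)

    classification : Classified
    classification =
      [ unlooped ∘ inj₁ ∘ case-I , (λ ¬1 →
      [ unlooped ∘ inj₂ ∘ inj₁ ∘ case-II , (λ ¬2 → Nontrivial.nontrivial ¬1 ¬2)
      ]′ (persistent-stage never-factors stage₁ (¬1 ∷ []) false 1 2 tt))
      ]′ (co-persistent-stage never-factors [] [] true 1 2 tt)

-- The orbit of a recurrent state.

module Orbit {m} (G : Graph (suc m)) (r : Fin (suc m) → ℤ) (U₀ : State (suc m)) (p : ℕ)
  (return : traj G r U₀ (suc p) ≡ U₀)
  (minimal : ∀ q → 1 ℕ.≤ q → q ℕ.< suc p → ¬ traj G r U₀ q ≡ U₀) where

  open Graph G using (adj) renaming (sym to adj-sym)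

  U : ℕ → State (suc m)
  U = traj G r U₀

  c : ℕ → Bool
  c = opinion₁ G r U₀

  conformists : State (suc m) → Fin m → Bool
  conformists V i = lookup V (suc i)

  count-χ : ∀ i V → + count G i V ≡
    χ (adj i zero ∧ lookup V zero) + sum (λ j → χ (adj i (suc j) ∧ conformists V j))
  count-χ i V = list-sum (λ j → if adj i j ∧ lookup V j then 1 else 0) id

  X-step : ∀ i t → conformists (U (suc t)) i ≡ does (r (suc i) ≤?
    χ (adj (suc i) zero ∧ c t) + sum (λ j → χ (adj (suc i) (suc j) ∧ conformists (U t) j)))
  X-step i t = trans (lookup∘tabulate (λ j → does (r (suc j) ≤? + count G (suc j) (U t))) i)
    (cong (λ z → does (r (suc i) ≤? z)) (count-χ (suc i) (U t)))

  c-step : ∀ t → c (suc t) ≡ does (χ (adj zero zero ∧ c t) +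
    sum (λ j → χ (adj (suc j) zero ∧ conformists (U t) j)) <? r zero)
  c-step t = cong (λ z → does (z <? r zero)) (trans (count-χ zero (U t))
    (cong (λ z → χ (adj zero zero ∧ c t) + z)
      (sum-cong-≗ λ j → cong (λ b → χ (b ∧ conformists (U t) j)) (adj-sym zero (suc j)))))

  U-shift : ∀ k {s t} → U s ≡ U t → U (k ℕ.+ s) ≡ U (k ℕ.+ t)
  U-shift zero    e = e
  U-shift (suc k) e = cong (step G r) (U-shift k e)

  U-period : ∀ t → U (suc p ℕ.+ t) ≡ U t
  U-period t = subst₂ (λ a b → U a ≡ U b) (ℕ.+-comm t (suc p)) (ℕ.+-identityʳ t) (U-shift t return)

  -- On a recurrent orbit time can be reversed: j further steps complete the k steps to a multiple
  -- of the period.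
  U-unshift : ∀ k {s t} → U (k ℕ.+ s) ≡ U (k ℕ.+ t) → U s ≡ U t
  U-unshift k {s} {t} e = trans (sym (forget s)) (trans (U-shift j e) (forget t))
    where
    j = k ℕ.* suc p ℕ.∸ k
    forget : ∀ t → U (j ℕ.+ (k ℕ.+ t)) ≡ U t
    forget t = trans (cong U (sym (ℕ.+-assoc j k t)))
      (trans (cong (λ n → U (n ℕ.+ t)) (ℕ.m∸n+n≡m (ℕ.m≤m*n k (suc p)))) (iterate-period U U-period k t))

  U-ext : ∀ {s t} → c s ≡ c t → (∀ i → conformists (U s) i ≡ conformists (U t) i) → U s ≡ U t
  U-ext {s} {t} cs≡ct Xs≡Xt = trans (sym (tabulate∘lookup (U s)))
    (trans
    (tabulate-cong {f = lookup (U s)} {g = lookup (U t)} λ { zero → cs≡ct ; (suc i) → Xs≡Xt i })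
    (tabulate∘lookup (U t)))

  period-divides : ∀ d → U d ≡ U₀ → suc p ∣ d
  period-divides d e = m%n≡0⇒n∣m d (suc p) (remainder (d % suc p) refl)
    where
    U% : U (d % suc p) ≡ U₀
    U% = trans (sym (trans (cong U (trans (m≡m%n+[m/n]*n d (suc p)) (ℕ.+-comm (d % suc p) _)))
                           (iterate-period U U-period (d / suc p) (d % suc p)))) e
    remainder : ∀ q → d % suc p ≡ q → q ≡ 0
    remainder zero    _ = refl
    remainder (suc q) e = contradiction (subst (λ z → U z ≡ U₀) e U%)
      (minimal (suc q) (s≤s z≤n) (subst (ℕ._< suc p) e (m%n<n d (suc p))))

  open Conformists (λ i j → adj (suc i) (suc j)) (λ i j → adj-sym (suc i) (suc j))
    (λ i → adj (suc i) zero) (adj zero zero) (r ∘ suc) (r zero) (conformists ∘ U) c X-step c-step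
    p (λ t → cong conformists (U-period t)) (λ t → cong (λ V → lookup V zero) (U-period t))

  classified : Classified
  -- Minimality concerns returns to the initial state, so the coincidence of times d + t and t is
  -- carried back to d and 0.
  classified = classification λ d t c≡ X≡ → period-divides d (U-unshift t {d} {0}
    (trans (cong U (ℕ.+-comm t d)) (trans (U-ext {d ℕ.+ t} {t} c≡ X≡) (cong U (sym (ℕ.+-identityʳ t))))))

theorem10 : (m : ℕ) (G : Graph (suc m)) (r : Fin (suc m) → ℤ) (U0 : State (suc m))
    → Recurrent G r U0 → (p : ℕ) → IsPeriod G r U0 p
    → Cases1to8 (opinion₁ G r U0) p
    × (NoLoops G → Cases1to6 (opinion₁ G r U0) p)
theorem10 m G r U0 _ (suc p) (_ , return , minimal) =
  Product.map₂ (λ loopless-if noLoops → loopless-if (noLoops zero)) (Orbit.classified G r U0 p return minimal)
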